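{- For all $n\ge 2$, $\delta(n,2)=n-1$.
   Context: Strings here are arbitrary (not normalized) finite words. The prefix reversal (flip) $f^{(i)}$ applied to $s=s_1\cdots s_n$ ($1\le i\le n$) yields $s_i s_{i-1}\cdots s_1 s_{i+1}\cdots s_n$. Two strings are \emph{compatible} if each symbol occurs the same number of times in both. For compatible $s,t$, $d(s,t)$ is the minimum number of prefix reversals transforming $s$ into $t$. $S(n,k)$ is the set of strings of length $n$ whose set of occurring symbols is exactly $\{0,\dots,k-1\}$, and $\delta(n,k)$ is the maximum of $d(s,t)$ over all compatible pairs $s,t\in S(n,k)$. -}

module Defs where

open import Data.Fin using (Fin; _≟_)
open import Data.List using (List; length; filter; reverse; take; drop; _++_)
open import Data.List.Membership.Propositional using (_∈_)
open import Data.Nat using (ℕ; zero; suc; _≤_)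
open import Data.Product using (_×_; ∃-syntax)
open import Relation.Binary.PropositionalEquality using (_≡_)

String : ℕ → Set
String k = List (Fin k)

flip : ∀ {k} → ℕ → String k → String k
flip i s = reverse (take i s) ++ drop i s

occurrences : ∀ {k} → Fin k → String k → ℕ
occurrences a s = length (filter (a ≟_) s)

Compatible : ∀ {k} → String k → String k → Set
Compatible s t = ∀ a → occurrences a s ≡ occurrences a t

-- s ⟶[ r ] t : some sequence of exactly r prefix reversals transforms s into t.
data _⟶[_]_ {k : ℕ} : String k → ℕ → String k → Set where
  done : ∀ {s} → s ⟶[ zero ] s
  step : ∀ {s t r} (i : ℕ) → 1 ≤ i → i ≤ length s →
         flip i s ⟶[ r ] t → s ⟶[ suc r ] t

-- The distance d(s,t), as a functional relation: d(s,t) = m.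
d[_,_]≡_ : ∀ {k} → String k → String k → ℕ → Set
d[ s , t ]≡ m = (s ⟶[ m ] t) × (∀ r → s ⟶[ r ] t → m ≤ r)

-- Membership in S(n,k).  The type of s already excludes symbols outside
-- {0,…,k-1}, so what remains is that each of these symbols occurs.
S : (n k : ℕ) → String k → Set
S n k s = length s ≡ n × (∀ a → a ∈ s)

-- δ(n,k) = m : the maximum of d(s,t) over compatible pairs in S(n,k) is m.
-- The second component asks constructively that every such d(s,t) exists,
-- so the bound does not hold vacuously.
δ[_,_]≡_ : ℕ → ℕ → ℕ → Set
δ[ n , k ]≡ m =
  (∃[ s ] ∃[ t ] S n k s × S n k t × Compatible s t × d[ s , t ]≡ m) ×
  (∀ s t → S n k s → S n k t → Compatible s t →
     ∃[ m′ ] d[ s , t ]≡ m′ × m′ ≤ m)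

{-# OPTIONS --safe #-}

-- Upper bound, by strong induction on the length: it suffices to make the last j
-- symbols of s and t agree using j ≥ 1 flips of s (or of t, as flips are
-- invertible) with at least one symbol remaining, since the remaining n - j symbols
-- then need at most n - j - 1 flips.  One flip does this unless
-- s = a…a and t = b…b with a ≠ b.  In that case two flips rotate any factor of s to
-- its end, so we are done if s contains the last two symbols of t; otherwise the
-- b's of s are isolated or absent and s has more a's than b's.  Symmetrically t has
-- more b's than a's, contradicting compatibility.
--
-- Lower bound: s ↦ breaks (s 1), the number of unequal adjacent pairs after
-- appending a sentinel 1, decreases by at most one per flip, since every flip then
-- alters a single adjacency.  It equals n on the alternating string ending in 0, and
-- is at most 1 on 0…01…1.
module Submission where

open import Defs
open import Data.Bool using (true; false; if_then_else_)
open import Data.Fin using (Fin; zero; suc; _≟_; opposite)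
open import Data.List using ([]; _∷_; [_]; _++_; _∷ʳ_; length; reverse; replicate; take; drop; filter;
  initLast; _∷ʳ′_)
open import Data.List.Membership.Propositional using (_∈_)
open import Data.List.Properties using (length-++; length-reverse; length-replicate; length-take;
  take++drop≡id; reverse-++; reverse-involutive; unfold-reverse; ++-assoc; ++-identityʳ; filter-++;
  filter-accept; filter-reject; filter-all; filter-none; ≡-dec)
open import Data.List.Relation.Binary.Permutation.Propositional using (_↭_; ↭-sym; ↭-trans; ↭-reflexive)
open import Data.List.Relation.Binary.Permutation.Propositional.Properties
  using (++⁺ʳ; ↭-reverse; ↭-length; filter-↭; ∈-resp-↭)
open import Data.List.Relation.Unary.All.Properties using (replicate⁺)
open import Data.List.Relation.Unary.Any using (here; there)
open import Data.Nat using (ℕ; zero; suc; _+_; _∸_; _≤_; _<_; z≤n; s≤s; _≤?_)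
open import Data.Nat.Induction using (Acc; acc; <-wellFounded)
open import Data.Nat.Properties hiding (_≟_; _≤?_)
open import Data.Product using (_×_; _,_; proj₁; proj₂; ∃-syntax; ∃₂)
open import Data.Sum using (_⊎_; inj₁; inj₂; [_,_]′)
open import Function using (_∘_)
open import Relation.Binary.PropositionalEquality using (_≡_; _≢_; refl; sym; trans; cong; cong₂;
  subst; subst₂; module ≡-Reasoning)
open import Relation.Nullary using (Dec; does; yes; no; contradiction; _×-dec_)
open import Relation.Nullary.Decidable using (map′; decidable-stable)
open import Relation.Unary using (Decidable)

private
  variable
    k r r′ : ℕ
    a b x : Fin k
    s t u : String k

-- Basic properties of flip sequences.

split-at : ∀ i (s : String k) → i ≤ length s → ∃₂ λ p q → s ≡ p ++ q × length p ≡ i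
split-at i s i≤ =
  take i s , drop i s , sym (take++drop≡id i s) , trans (length-take i s) (m≤n⇒m⊓n≡m i≤)

flip-prefix : ∀ (p q : String k) → flip (length p) (p ++ q) ≡ reverse p ++ q
flip-prefix p q = cong₂ (λ u v → reverse u ++ v) (take-prefix p) (drop-prefix p)
  where
  take-prefix : ∀ p → take (length p) (p ++ q) ≡ p
  take-prefix []      = refl
  take-prefix (x ∷ p) = cong (x ∷_) (take-prefix p)
  drop-prefix : ∀ p → drop (length p) (p ++ q) ≡ q
  drop-prefix []      = refl
  drop-prefix (x ∷ p) = drop-prefix p

length-prefix-≤ : ∀ (p q : String k) → length p ≤ length (p ++ q)
length-prefix-≤ p q = ≤-trans (m≤m+n _ _) (≤-reflexive (sym (length-++ p)))

⟶-respˡ : s ≡ t → s ⟶[ r ] u → t ⟶[ r ] u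
⟶-respˡ refl m = m

step-prefix : ∀ (p q : String k) → 1 ≤ length p → (reverse p ++ q) ⟶[ r ] t →
              (p ++ q) ⟶[ suc r ] t
step-prefix p q 1≤p m =
  step (length p) 1≤p (length-prefix-≤ p q) (⟶-respˡ (sym (flip-prefix p q)) m)

step-full : 1 ≤ length s → reverse s ⟶[ r ] t → s ⟶[ suc r ] t
step-full {s = s} 1≤s m = ⟶-respˡ (++-identityʳ s)
  (step-prefix s [] 1≤s (⟶-respˡ (sym (++-identityʳ (reverse s))) m))

-- A flip of length one changes nothing. Since `s ⟶[ r ] t` counts flips exactly, this pads a
-- sequence that is one flip too short.
step-trivial : 1 ≤ length s → s ⟶[ r ] t → s ⟶[ suc r ] t
step-trivial {s = x ∷ s} _ = step-prefix [ x ] s (s≤s z≤n)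

⟶-trans : s ⟶[ r ] t → t ⟶[ r′ ] u → s ⟶[ r + r′ ] u
⟶-trans done            n = n
⟶-trans (step i l h m) n = step i l h (⟶-trans m n)

-- Reversing the same prefix twice restores it, so each flip undoes itself and the sequence can be
-- run backwards.
⟶-sym : s ⟶[ r ] t → t ⟶[ r ] s
⟶-sym done = done
⟶-sym {t = t} (step {s = s} {r = r} i 1≤i i≤s m) with split-at i s i≤s
... | p , q , refl , refl =
  subst (λ r → t ⟶[ r ] (p ++ q)) (+-comm r 1) (⟶-trans (⟶-sym m) back)
  where
  back : flip (length p) (p ++ q) ⟶[ 1 ] (p ++ q)
  back = ⟶-respˡ (sym (flip-prefix p q))
    (step-prefix (reverse p) q (subst (1 ≤_) (sym (length-reverse p)) 1≤i)
      (⟶-respˡ (cong (_++ q) (sym (reverse-involutive p))) done))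

-- Flips touch only a prefix, so a suffix rides along unchanged at no cost.
⟶-++ʳ : ∀ w → s ⟶[ r ] t → (s ++ w) ⟶[ r ] (t ++ w)
⟶-++ʳ w done = done
⟶-++ʳ w (step {s = s} i 1≤i i≤s m) with split-at i s i≤s
... | p , q , refl , refl = ⟶-respˡ (sym (++-assoc p q w))
  (step-prefix p (q ++ w) 1≤i
    (⟶-respˡ
      (trans (cong (_++ w) (flip-prefix p q)) (++-assoc (reverse p) q w))
      (⟶-++ʳ w m)))

⟶⇒↭ : s ⟶[ r ] t → s ↭ t
⟶⇒↭ done = ↭-reflexive refl
⟶⇒↭ (step {s = s} i _ i≤s m) with split-at i s i≤s
... | p , q , refl , refl = ↭-trans (++⁺ʳ q (↭-sym (↭-reverse p)))
  (↭-trans (↭-reflexive (sym (flip-prefix p q))) (⟶⇒↭ m))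

-- Existence of the distance, by finite search.

⟶-dec : ∀ (s : String k) r t → Dec (s ⟶[ r ] t)
⟶-dec s zero    t = map′ (λ { refl → done }) (λ { done → refl }) (≡-dec _≟_ s t)
⟶-dec s (suc r) t = map′
  (λ { (i , s≤s i≤s , 1≤i , m) → step i 1≤i i≤s m })
  (λ { (step i 1≤i i≤s m) → i , s≤s i≤s , 1≤i , m })
  -- The search is over `i` strictly below its bound, hence the successor to include the full flip.
  (anyUpTo? (λ i → (1 ≤? i) ×-dec ⟶-dec (flip i s) r t) (suc (length s)))

-- Descends: any smaller witness replaces `n`, until none is left.
minimum : ∀ {P : ℕ → Set} → Decidable P → ∀ n → P n → ∃[ m ] m ≤ n × P m × (∀ r → P r → m ≤ r)
minimum {P} P? n = go n (<-wellFounded n)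
  where
  go : ∀ n → Acc _<_ n → P n → ∃[ m ] m ≤ n × P m × (∀ r → P r → m ≤ r)
  go n (acc rec) Pn with anyUpTo? P? n
  ... | no ∄         = n , ≤-refl , Pn , λ r Pr → ≮⇒≥ λ r<n → ∄ (r , r<n , Pr)
  ... | yes (i , i<n , Pi) with go i (rec i<n) Pi
  ...   | m , m≤i , rest = m , ≤-trans m≤i (<⇒≤ i<n) , rest

-- Symbol counts and compatibility.

occurrences-++ : ∀ (a : Fin k) s t → occurrences a (s ++ t) ≡ occurrences a s + occurrences a t
occurrences-++ a s t = trans (cong length (filter-++ (a ≟_) s t)) (length-++ (filter (a ≟_) s))

occurrences-↭ : ∀ (a : Fin k) → s ↭ t → occurrences a s ≡ occurrences a t
occurrences-↭ a p = ↭-length (filter-↭ (a ≟_) p)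

occurrences-≡ : ∀ (a : Fin k) s → occurrences a (a ∷ s) ≡ suc (occurrences a s)
occurrences-≡ a s = cong length (filter-accept (a ≟_) refl)

occurrences-≢ : ∀ s → a ≢ b → occurrences a (b ∷ s) ≡ occurrences a s
occurrences-≢ {a = a} s a≢b = cong length (filter-reject (a ≟_) a≢b)

Compatible-++ʳ⁻ : ∀ (s t w : String k) → Compatible (s ++ w) (t ++ w) → Compatible s t
Compatible-++ʳ⁻ s t w eq a = +-cancelʳ-≡ (occurrences a w) _ _
  (trans (sym (occurrences-++ a s w)) (trans (eq a) (occurrences-++ a t w)))

length-binary : ∀ (s : String 2) → length s ≡ occurrences zero s + occurrences (suc zero) s
length-binary []             = refl
length-binary (zero     ∷ s) = cong suc (length-binary s)
length-binary (suc zero ∷ s) = trans (cong suc (length-binary s)) (sym (+-suc _ _))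

Compatible⇒length : ∀ (s t : String 2) → Compatible s t → length s ≡ length t
Compatible⇒length s t eq = trans (length-binary s)
  (trans (cong₂ _+_ (eq zero) (eq (suc zero))) (sym (length-binary t)))

binary : ∀ {a b : Fin 2} → a ≢ b → ∀ c → c ≡ a ⊎ c ≡ b
binary {zero}     {zero}     a≢b c          = contradiction refl a≢b
binary {zero}     {suc zero} a≢b zero       = inj₁ refl
binary {zero}     {suc zero} a≢b (suc zero) = inj₂ refl
binary {suc zero} {zero}     a≢b zero       = inj₂ refl
binary {suc zero} {zero}     a≢b (suc zero) = inj₁ refl
binary {suc zero} {suc zero} a≢b c          = contradiction refl a≢b

-- Upper bound

-- The tail `w` is put in place at one flip per symbol. Keeping `u` nonempty leaves room for the one
-- flip by which the bound undercuts the length.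
data Advance {k} : String k → String k → Set where
  advance : ∀ {s} u w t → 1 ≤ length u → 1 ≤ length w →
            s ⟶[ length w ] (u ++ w) → Advance s (t ++ w)

-- Flipping `p ++ w` and then the whole string reverses `w` twice, so it reaches the end in its
-- original orientation.
⟶-rotate : ∀ (p q w : String k) → 1 ≤ length w →
           (p ++ w ++ q) ⟶[ 2 ] ((reverse q ++ p) ++ w)
⟶-rotate p q w 1≤w = ⟶-respˡ (++-assoc p w q)
  (step-prefix (p ++ w) q nonempty
    (step-full (≤-trans (≤-trans nonempty (≤-reflexive (sym (length-reverse (p ++ w)))))
                        (length-prefix-≤ (reverse (p ++ w)) q))
      (⟶-respˡ (sym reversed) done)))
  where
  nonempty : 1 ≤ length (p ++ w)
  nonempty = ≤-trans 1≤w (≤-trans (m≤n+m _ _) (≤-reflexive (sym (length-++ p))))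
  open ≡-Reasoning
  reversed : reverse (reverse (p ++ w) ++ q) ≡ (reverse q ++ p) ++ w
  reversed = begin
    reverse (reverse (p ++ w) ++ q)          ≡⟨ reverse-++ (reverse (p ++ w)) q ⟩
    reverse q ++ reverse (reverse (p ++ w))  ≡⟨ cong (reverse q ++_) (reverse-involutive (p ++ w)) ⟩
    reverse q ++ p ++ w                      ≡⟨ ++-assoc (reverse q) p w ⟨
    (reverse q ++ p) ++ w                    ∎

Factor : String k → String k → Set
Factor w s = ∃₂ λ p q → s ≡ p ++ w ++ q

factor-∷ : ∀ {w} → Factor w s → Factor w (x ∷ s)
factor-∷ {x = x} (p , q , refl) = x ∷ p , q , refl

-- If `x` is `a`, the first `b` comes right after an `a` and gives the factor. If `x` is `b` and the
-- factor is absent, each `b` comes right after an `a` of its own, which bounds the count.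
factor-or-fewer : ∀ {a b : Fin 2} → a ≢ b → ∀ x v →
  Factor (x ∷ b ∷ []) (a ∷ v) ⊎ occurrences b (a ∷ v) ≤ occurrences a (a ∷ v)
factor-or-fewer {a} {b} a≢b x = go
  where
  fewer : ∀ {v} → occurrences b v ≤ suc (occurrences a v) →
          occurrences b (a ∷ v) ≤ occurrences a (a ∷ v)
  fewer {v} = subst₂ _≤_ (sym (occurrences-≢ v (a≢b ∘ sym))) (sym (occurrences-≡ a v))
  fewer-pair : ∀ {v} → occurrences b v ≤ occurrences a v →
               occurrences b (a ∷ b ∷ v) ≤ occurrences a (a ∷ b ∷ v)
  fewer-pair {v} l = fewer
    (subst₂ _≤_ (sym (occurrences-≡ b v)) (cong suc (sym (occurrences-≢ v a≢b))) (s≤s l))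
  go : ∀ v → Factor (x ∷ b ∷ []) (a ∷ v) ⊎ occurrences b (a ∷ v) ≤ occurrences a (a ∷ v)
  go [] = inj₂ (fewer z≤n)
  go (c ∷ v) with binary a≢b c
  go (c ∷ v) | inj₁ refl with go v
  ... | inj₁ f = inj₁ (factor-∷ f)
  ... | inj₂ l = inj₂ (fewer (m≤n⇒m≤1+n l))
  go (c ∷ v) | inj₂ refl with binary a≢b x
  go (c ∷ v)     | inj₂ refl | inj₁ refl = inj₁ ([] , v , refl)
  go (c ∷ [])    | inj₂ refl | inj₂ refl = inj₂ (fewer-pair z≤n)
  go (c ∷ d ∷ v) | inj₂ refl | inj₂ refl with binary a≢b d
  ... | inj₂ refl = inj₁ ([ a ] , v , refl)
  -- The leading pair `a`, `b` is dropped, and `d`, now equal to `a`, heads the string of the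
  -- recursive call.
  ... | inj₁ refl with go v
  ...   | inj₁ f = inj₁ (factor-∷ (factor-∷ f))
  ...   | inj₂ l = inj₂ (fewer-pair l)

-- The factor is sought in `a ∷ v`, without the last `a`. That last symbol makes the remainder
-- nonempty in one case and the inequality strict in the other.
advance-or-fewer : ∀ {a b : Fin 2} → a ≢ b → ∀ v x t → let s = a ∷ v ∷ʳ a in
  Advance s (t ++ x ∷ b ∷ []) ⊎ occurrences b s < occurrences a s
advance-or-fewer {a} {b} a≢b v x t with factor-or-fewer a≢b x v
... | inj₁ (p , q , eq) = inj₁
  (advance (reverse (q ∷ʳ a) ++ p) w t
    (subst (λ z → 1 ≤ length (z ++ p)) (sym (reverse-++ q [ a ])) (s≤s z≤n)) (s≤s z≤n)
    (⟶-respˡ (sym (trans (cong (_∷ʳ a) eq) (++-assoc p (w ++ q) [ a ])))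
      (⟶-rotate p (q ∷ʳ a) w (s≤s z≤n))))
  where w = x ∷ b ∷ []
... | inj₂ l = inj₂ (subst₂ _<_
  (sym (trans (occurrences-++ b (a ∷ v) [ a ])
    (trans (cong (occurrences b (a ∷ v) +_) (occurrences-≢ [] (a≢b ∘ sym))) (+-identityʳ _))))
  (sym (trans (occurrences-++ a (a ∷ v) [ a ])
    (trans (cong (occurrences a (a ∷ v) +_) (occurrences-≡ a [])) (+-comm _ 1))))
  (s≤s l))

1≤length-∷ʳ : ∀ (s : String k) a → 1 ≤ length (s ∷ʳ a)
1≤length-∷ʳ []      a = s≤s z≤n
1≤length-∷ʳ (x ∷ s) a = s≤s z≤n

snoc-view : ∀ (x : Fin k) s → ∃₂ λ t y → x ∷ s ≡ t ∷ʳ y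
snoc-view x []      = [] , x , refl
snoc-view x (y ∷ s) with snoc-view y s
... | t , z , eq = x ∷ t , z , cong (x ∷_) eq

advance-or-fewer′ : ∀ {a b : Fin 2} → a ≢ b → ∀ v y v′ → let s = a ∷ v ∷ʳ a in
  Advance s (y ∷ v′ ∷ʳ b) ⊎ occurrences b s < occurrences a s
advance-or-fewer′ {a} {b} a≢b v y v′ with snoc-view y v′
... | t , x , eq = subst (λ z → Advance _ z ⊎ _)
  (sym (trans (cong (_∷ʳ b) eq) (++-assoc t [ x ] [ b ]))) (advance-or-fewer a≢b v x t)

-- Nothing has to move, but `Advance` asks for exactly one flip for the tail `[ b ]`, so a trivial
-- flip is spent.
Advance-last : ∀ (s : String k) b t → 1 ≤ length s → Advance (s ∷ʳ b) (t ∷ʳ b)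
Advance-last s b t 1≤s = advance s [ b ] t 1≤s (s≤s z≤n)
  (step-trivial (≤-trans 1≤s (length-prefix-≤ s [ b ])) done)

Advance-full : ∀ (b : Fin k) s t → 1 ≤ length s → Advance (b ∷ s) (t ∷ʳ b)
Advance-full b s t 1≤s = advance (reverse s) [ b ] t
  (subst (1 ≤_) (sym (length-reverse s)) 1≤s) (s≤s z≤n)
  (step-full (s≤s z≤n) (⟶-respˡ (sym (unfold-reverse b s)) done))

advance-one : ∀ (s t : String 2) → 2 ≤ length s → Compatible s t → Advance s t ⊎ Advance t s
advance-one s t 2≤s eq = go s t 2≤s (subst (2 ≤_) (Compatible⇒length s t eq) 2≤s) eq
  where
  ends : ∀ a v b v′ → a ≢ b → Compatible (a ∷ v ∷ʳ a) (b ∷ v′ ∷ʳ b) →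
         Advance (a ∷ v ∷ʳ a) (b ∷ v′ ∷ʳ b) ⊎ Advance (b ∷ v′ ∷ʳ b) (a ∷ v ∷ʳ a)
  ends a v b v′ a≢b eq
    with advance-or-fewer′ a≢b v b v′ | advance-or-fewer′ (a≢b ∘ sym) v′ a v
  ... | inj₁ adv | _        = inj₁ adv
  ... | _        | inj₁ adv = inj₂ adv
  ... | inj₂ l   | inj₂ l′  =
    contradiction (subst₂ _<_ (sym (eq a)) (sym (eq b)) l′) (<-asym l)

  go : ∀ s t → 2 ≤ length s → 2 ≤ length t → Compatible s t → Advance s t ⊎ Advance t s
  go s t 2≤s 2≤t eq with initLast s | initLast t
  go _ _ (s≤s ()) _ _ | [] ∷ʳ′ a | _
  go _ _ _ (s≤s ()) _ | _ | [] ∷ʳ′ b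
  go _ _ _ _ eq | (x ∷ v) ∷ʳ′ a | (y ∷ v′) ∷ʳ′ b with a ≟ b
  ... | yes refl = inj₁ (Advance-last (x ∷ v) a (y ∷ v′) (s≤s z≤n))
  ... | no a≢b with binary a≢b x
  ...   | inj₂ refl = inj₁ (Advance-full b (v ∷ʳ a) (y ∷ v′) (1≤length-∷ʳ v a))
  ...   | inj₁ refl with binary a≢b y
  ...     | inj₁ refl = inj₂ (Advance-full a (v′ ∷ʳ b) (x ∷ v) (1≤length-∷ʳ v′ b))
  -- No single flip works: each string begins and ends with its own symbol.
  ...     | inj₂ refl = ends a v b v′ a≢b eq

-- The length is written `suc n` so that the bound is `n` itself. In the base case the counts
-- determine the single symbol.
⟶-within-length : ∀ n → Acc _<_ n → ∀ (s t : String 2) → length s ≡ suc n → Compatible s t →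
                  s ⟶[ n ] t
⟶-within-length zero _ (a ∷ []) t len eq = subst (_ ⟶[ 0 ]_) (singleton a t eq) done
  where
  singleton : ∀ a t → Compatible [ a ] t → [ a ] ≡ t
  singleton a []          eq = contradiction (Compatible⇒length [ a ] [] eq) λ ()
  singleton a (b ∷ c ∷ t) eq = contradiction (Compatible⇒length [ a ] (b ∷ c ∷ t) eq) λ ()
  singleton a (b ∷ [])    eq = decidable-stable (≡-dec _≟_ [ a ] [ b ]) λ [a]≢[b] →
    contradiction
      (trans (sym (occurrences-≡ a [])) (trans (eq a) (occurrences-≢ [] ([a]≢[b] ∘ cong [_]))))
      λ ()
⟶-within-length n@(suc _) (acc rec) s t len eq =
  [ (λ adv → via adv len eq)
  -- Here the advance moves `t`, so the sequence found leads from `t` to `s` and is inverted.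
  , (λ adv → ⟶-sym (via adv (trans (sym (Compatible⇒length s t eq)) len) (sym ∘ eq)))
  ]′ (advance-one s t (subst (2 ≤_) (sym len) (s≤s (s≤s z≤n))) eq)
  where
  via : ∀ {s t} → Advance s t → length s ≡ suc n → Compatible s t → s ⟶[ n ] t
  -- Of the `n` flips, `length w` settle the tail; the other `length u′` are one fewer than the
  -- symbols of `u`, as the induction requires.
  via (advance {s} u@(_ ∷ u′) w t _ 1≤w m) len eq = subst (s ⟶[_] (t ++ w)) (sym n≡)
    (⟶-trans m (⟶-++ʳ w (⟶-within-length (length u′) (rec u′<n) u t refl compat)))
    where
    s↭ = ⟶⇒↭ m
    n≡ : n ≡ length w + length u′
    n≡ = trans (suc-injective (trans (sym len) (trans (↭-length s↭) (length-++ u))))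
      (+-comm (length u′) (length w))
    u′<n : length u′ < n
    u′<n = ≤-trans (+-monoˡ-≤ (length u′) 1≤w) (≤-reflexive (sym n≡))
    compat : Compatible u t
    compat = Compatible-++ʳ⁻ u t w λ a → trans (sym (occurrences-↭ a s↭)) (eq a)

-- Lower bound

unequal : Fin k → Fin k → ℕ
unequal x y = if does (x ≟ y) then 0 else 1

unequal-≤1 : ∀ (x y : Fin k) → unequal x y ≤ 1
unequal-≤1 x y with does (x ≟ y)
... | true  = z≤n
... | false = s≤s z≤n

unequal-sym : ∀ (x y : Fin k) → unequal x y ≡ unequal y x
unequal-sym x y with x ≟ y | y ≟ x
... | yes _   | yes _   = refl
... | no _    | no _    = refl
... | yes x≡y | no y≢x  = contradiction (sym x≡y) y≢x
... | no x≢y  | yes y≡x = contradiction (sym y≡x) x≢y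

breaks : String k → ℕ
breaks []          = 0
breaks (x ∷ [])    = 0
breaks (x ∷ y ∷ s) = unequal x y + breaks (y ∷ s)

-- `breaks` recurses from the left; this peels off the rightmost adjacency, which is where reversal
-- sends the first one.
breaks-∷ʳ² : ∀ s (x y : Fin k) → breaks (s ++ x ∷ y ∷ []) ≡ breaks (s ∷ʳ x) + unequal x y
breaks-∷ʳ² []          x y = +-identityʳ _
breaks-∷ʳ² (z ∷ [])    x y = trans (cong (unequal z x +_) (breaks-∷ʳ² [] x y))
  (cong (_+ unequal x y) (sym (+-identityʳ _)))
breaks-∷ʳ² (z ∷ w ∷ s) x y = trans (cong (unequal z w +_) (breaks-∷ʳ² (w ∷ s) x y))
  (sym (+-assoc (unequal z w) _ _))

breaks-reverse : ∀ (s : String k) → breaks (reverse s) ≡ breaks s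
breaks-reverse []          = refl
breaks-reverse (x ∷ [])    = refl
breaks-reverse (x ∷ y ∷ s) = begin
  breaks (reverse (x ∷ y ∷ s))            ≡⟨ cong breaks (reverse-++ (x ∷ y ∷ []) s) ⟩
  breaks (reverse s ++ y ∷ x ∷ [])        ≡⟨ breaks-∷ʳ² (reverse s) y x ⟩
  breaks (reverse s ∷ʳ y) + unequal y x   ≡⟨ cong₂ _+_ (cong breaks (sym (unfold-reverse y s))) (unequal-sym y x) ⟩
  breaks (reverse (y ∷ s)) + unequal x y  ≡⟨ cong (_+ unequal x y) (breaks-reverse (y ∷ s)) ⟩
  breaks (y ∷ s) + unequal x y            ≡⟨ +-comm (breaks (y ∷ s)) _ ⟩
  unequal x y + breaks (y ∷ s)            ∎
  where open ≡-Reasoning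

breaks-++-≤ : ∀ (p q : String k) → breaks (p ++ q) ≤ suc (breaks p + breaks q)
breaks-++-≤ []          q       = n≤1+n _
breaks-++-≤ (x ∷ [])    []      = z≤n
breaks-++-≤ (x ∷ [])    (y ∷ q) = +-monoˡ-≤ _ (unequal-≤1 x y)
breaks-++-≤ (x ∷ y ∷ p) q       = begin
  unequal x y + breaks ((y ∷ p) ++ q)             ≤⟨ +-monoʳ-≤ (unequal x y) (breaks-++-≤ (y ∷ p) q) ⟩
  unequal x y + suc (breaks (y ∷ p) + breaks q)   ≡⟨ +-suc (unequal x y) _ ⟩
  suc (unequal x y + (breaks (y ∷ p) + breaks q)) ≡⟨ cong suc (+-assoc (unequal x y) _ _) ⟨
  suc (unequal x y + breaks (y ∷ p) + breaks q)   ∎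
  where open ≤-Reasoning

breaks-++-≥ : ∀ (p q : String k) → breaks p + breaks q ≤ breaks (p ++ q)
breaks-++-≥ []          q       = ≤-refl
breaks-++-≥ (x ∷ [])    []      = z≤n
breaks-++-≥ (x ∷ [])    (y ∷ q) = m≤n+m _ _
breaks-++-≥ (x ∷ y ∷ p) q       = ≤-trans (≤-reflexive (+-assoc (unequal x y) _ _))
  (+-monoʳ-≤ (unequal x y) (breaks-++-≥ (y ∷ p) q))

-- Cutting `p ++ q` loses at most the adjacency at the cut, reversing `p` loses none, and rejoining
-- can only add.
breaks-⟶ : s ⟶[ r ] t → breaks s ≤ r + breaks t
breaks-⟶ done = ≤-refl
breaks-⟶ {t = t} (step {s = s} {r = r} i _ i≤s m) with split-at i s i≤s
... | p , q , refl , refl = begin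
  breaks (p ++ q)                       ≤⟨ breaks-++-≤ p q ⟩
  suc (breaks p + breaks q)             ≡⟨ cong (λ z → suc (z + breaks q)) (breaks-reverse p) ⟨
  suc (breaks (reverse p) + breaks q)   ≤⟨ s≤s (breaks-++-≥ (reverse p) q) ⟩
  suc (breaks (reverse p ++ q))         ≡⟨ cong (suc ∘ breaks) (flip-prefix p q) ⟨
  suc (breaks (flip (length p) (p ++ q))) ≤⟨ s≤s (breaks-⟶ m) ⟩
  suc (r + breaks t)                    ∎
  where open ≤-Reasoning

-- The extremal pair: an alternating string and its sorted rearrangement.

parity : ℕ → Fin 2
parity zero    = suc zero
parity (suc n) = opposite (parity n)

-- Parities are listed from `n` down to 1, so the string ends in 0 and an appended sentinel, equal
-- to `parity 0`, continues the alternation.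
alternating : ℕ → String 2
alternating zero    = []
alternating (suc n) = parity (suc n) ∷ alternating n

length-alternating : ∀ n → length (alternating n) ≡ n
length-alternating zero    = refl
length-alternating (suc n) = cong suc (length-alternating n)

-- The first two letters are opposite, so they already cover both symbols.
∈-alternating : ∀ n a → a ∈ alternating (2 + n)
∈-alternating n a with parity n
∈-alternating n zero       | zero     = here refl
∈-alternating n zero       | suc zero = there (here refl)
∈-alternating n (suc zero) | zero     = there (here refl)
∈-alternating n (suc zero) | suc zero = here refl

breaks-alternating : ∀ n → breaks (alternating n ∷ʳ suc zero) ≡ n
breaks-alternating zero          = refl
breaks-alternating (suc zero)    = refl
breaks-alternating (suc (suc n)) =
  cong₂ _+_ (unequal-opposite (parity (suc n))) (breaks-alternating (suc n))
  where
  unequal-opposite : ∀ x → unequal {2} (opposite x) x ≡ 1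
  unequal-opposite zero       = refl
  unequal-opposite (suc zero) = refl

sorted : ℕ → ℕ → String 2
sorted m n = replicate m zero ++ replicate n (suc zero)

occurrences-replicate : ∀ (a : Fin k) n → occurrences a (replicate n a) ≡ n
occurrences-replicate a n =
  trans (cong length (filter-all (a ≟_) (replicate⁺ n refl))) (length-replicate n)

occurrences-replicate-≢ : a ≢ b → ∀ n → occurrences a (replicate n b) ≡ 0
occurrences-replicate-≢ a≢b n = cong length (filter-none (_ ≟_) (replicate⁺ n a≢b))

sorted-compatible : ∀ s → Compatible s (sorted (occurrences zero s) (occurrences (suc zero) s))
sorted-compatible s a = sym (trans (occurrences-++ a (replicate m zero) _) (count a))
  where
  m = occurrences zero s
  n = occurrences (suc zero) s
  count : ∀ a → occurrences a (replicate m zero) + occurrences a (replicate n (suc zero)) ≡ occurrences a s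
  count zero       = trans (cong₂ _+_ (occurrences-replicate zero m) (occurrences-replicate-≢ (λ ()) n))
    (+-identityʳ m)
  count (suc zero) = cong₂ _+_ (occurrences-replicate-≢ (λ ()) m) (occurrences-replicate (suc zero) n)

-- The only possible break is where the zeros end; a sentinel placed after ones adds none.
breaks-sorted : ∀ m n → breaks (sorted m n ∷ʳ suc zero) ≤ 1
breaks-sorted zero          zero          = z≤n
breaks-sorted zero          (suc zero)    = z≤n
breaks-sorted zero          (suc (suc n)) = breaks-sorted zero (suc n)
breaks-sorted (suc zero)    zero          = ≤-refl
breaks-sorted (suc zero)    (suc n)       = s≤s (≤-reflexive (ones n))
  where
  ones : ∀ n → breaks (sorted zero (suc n) ∷ʳ suc zero) ≡ 0
  ones zero    = refl
  ones (suc n) = ones n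
breaks-sorted (suc (suc m)) n             = breaks-sorted (suc m) n

theorem5p1 : ∀ (n : ℕ) → 2 ≤ n → δ[ n , 2 ]≡ (n ∸ 1)
theorem5p1 (suc zero) (s≤s ())
theorem5p1 n@(suc (suc m)) _ =
  (σ , τ , σ∈S , τ∈S , compat , σ⟶τ , lower) , upper
  where
  within : ∀ s t → length s ≡ n → Compatible s t → s ⟶[ suc m ] t
  within = ⟶-within-length (suc m) (<-wellFounded (suc m))

  σ τ : String 2
  σ = alternating n
  τ = sorted (occurrences zero σ) (occurrences (suc zero) σ)

  compat : Compatible σ τ
  compat = sorted-compatible σ

  σ⟶τ : σ ⟶[ suc m ] τ
  σ⟶τ = within σ τ (length-alternating n) compat

  σ∈S : S n 2 σ
  σ∈S = length-alternating n , ∈-alternating m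

  -- The flip sequence makes `τ` a permutation of `σ`, so it inherits the length and both symbols.
  τ∈S : S n 2 τ
  τ∈S = trans (sym (↭-length (⟶⇒↭ σ⟶τ))) (proj₁ σ∈S) , ∈-resp-↭ (⟶⇒↭ σ⟶τ) ∘ proj₂ σ∈S

  lower : ∀ r → σ ⟶[ r ] τ → suc m ≤ r
  -- The sentinel stays fixed along the path; the one break that `τ` may keep accounts for the
  -- difference between `n` and `suc m`.
  lower r path = +-cancelʳ-≤ 1 _ _ (begin
    suc m + 1                       ≡⟨ +-comm (suc m) 1 ⟩
    n                               ≡⟨ breaks-alternating n ⟨
    breaks (σ ∷ʳ suc zero)          ≤⟨ breaks-⟶ (⟶-++ʳ [ suc zero ] path) ⟩
    r + breaks (τ ∷ʳ suc zero)      ≤⟨ +-monoʳ-≤ r (breaks-sorted (occurrences zero σ) _) ⟩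
    r + 1                           ∎)
    where open ≤-Reasoning

  upper : ∀ s t → S n 2 s → S n 2 t → Compatible s t → ∃[ d ] d[ s , t ]≡ d × d ≤ suc m
  -- A sequence of exactly `suc m` flips exists, so the search for the least number starts there and
  -- cannot end above it.
  upper s t (len , _) _ eq with minimum (λ r → ⟶-dec s r t) (suc m) (within s t len eq)
  ... | d , d≤ , path , least = d , (path , least) , d≤
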